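{- Let $n\ge 2$. The correspondences $\mathbf A\mapsto\mathbf A^*$ and $\mathbf B\mapsto\mathbf B^\bullet$ define a term equivalence between the variety of $n\mathrm{BA}$s and the variety of skew star algebras. More precisely: (i) if $\mathbf A$ is an $n\mathrm{BA}$, then $\mathbf A^*$ is a skew star algebra; (ii) if $\mathbf B$ is a skew star algebra, then $\mathbf B^\bullet$ is an $n\mathrm{BA}$; (iii) $(\mathbf A^*)^\bullet=\mathbf A$ for every $n\mathrm{BA}$ $\mathbf A$; (iv) $(\mathbf B^\bullet)^*=\mathbf B$ for every skew star algebra $\mathbf B$.
   Context: Let $n\ge 2$. An $n\mathrm{BA}$ (Boolean-like algebra of dimension $n$) is an algebra $\mathbf A=(A,q,\mathsf e_1,\dots,\mathsf e_n)$ with $q$ of arity $n+1$ and constants $\mathsf e_1,\dots,\mathsf e_n$ satisfying the identities (B0) $q(\mathsf e_i,x^1,\dots,x^n)=x^i$ for $i=1,\dots,n$; (B1) $q(y,x,\dots,x)=x$; (B2) $q(y,q(y,x^{11},\dots,x^{1n}),\dots,q(y,x^{n1},\dots,x^{nn}))=q(y,x^{11},x^{22},\dots,x^{nn})$; (B3) $q(y,q(x^{10},\dots,x^{1n}),\dots,q(x^{n0},\dots,x^{nn}))=q(q(y,x^{10},\dots,x^{n0}),\dots,q(y,x^{1n},\dots,x^{nn}))$; (B4) $q(y,\mathsf e_1,\dots,\mathsf e_n)=y$. A semicentral right Church algebra (SRCA) is an algebra $(A,t,0)$ of type $(3,0)$ such that $t(0,x,y)=y$ for all $x,y$, and such that for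 every $x\in A$: $t(x,x,0)=x$, and $f_x(a,b)=t(x,a,b)$ is a binary decomposition operator on $(A,t,0)$, i.e. $f_x(a,a)=a$; $f_x(f_x(a,b),f_x(c,d))=f_x(a,d)$; and $f_x$ is a homomorphism $(A,t,0)^2\to(A,t,0)$. A skew star algebra is an algebra $\mathbf B=(B,t_i,0_i)_{1\le i\le n}$, each $t_i$ ternary and each $0_i$ a constant, such that for all $i\ne j$ in $\{1,\dots,n\}$: (N0) $(B,t_i,0_i)$ is an SRCA for every $1\le i\le n$; (N1) $t_i(0_j,y,z)=y$; (N2) $t_1(x,t_2(x,t_3(x,(\dots t_{n-1}(x,0_n,0_{n-1})\dots),0_3),0_2),0_1)=x$; (N3) $t_i(x,t_j(x,y,z),u)=t_j(x,t_i(x,y,u),z)$; (N4) for every $1\le i\le n$, $t_i(x,y,z)=t_1(x,t_2(x,t_3(x,\dots t_{n-1}(x,w_n,w_{n-1})\dots,w_3),w_2),w_1)$, where $w_i=z$ and $w_k=y$ for all $k\ne i$; (N5) $t_i(x,t_j(y^1,y^2,y^3),t_j(z^1,z^2,z^3))=t_j(t_i(x,y^1,z^1),t_i(x,y^2,z^2),t_i(x,y^3,z^3))$. Correspondences. For an $n\mathrm{BA}$ $\mathbf A$, $\mathbf A^*=(A,t_i,0_i)_{1\le i\le n}$ where $0_i:=\mathsf e_i$ and $t_i(x,y,z):=q(x,w_1,\dots,w_n)$ with $w_i=z$ and $w_k=y$ for $k\neq i$. For a skew star algebra $\mathbf B$, $\mathbf B^\bullet=(B,q_t,\mathsf e_1,\dots,\mathsf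 e_n)$ where $\mathsf e_i:=0_i$ and $$q_t(x,y_1,\dots,y_n):=t_1(x,t_2(x,t_3(x,\dots t_{n-1}(x,y_n,y_{n-1})\dots,y_3),y_2),y_1).$$ -}

module Defs where

open import Data.Fin.Base using (Fin; zero; suc)
open import Data.Nat.Base using (ℕ; zero; suc; NonTrivial)
open import Data.Product.Base using (_×_; _,_; uncurry)
open import Data.Product.Relation.Binary.Pointwise.NonDependent using (×-setoid)
open import Data.Vec.Functional using (Vector; head; tail; replicate; updateAt)
open import Function.Base using (const)
open import Level using (Level; _⊔_)
open import Relation.Binary.Bundles using (Setoid)
open import Relation.Binary.PropositionalEquality.Core using (_≢_)

private
  variable
    c ℓ c′ ℓ′ : Level

-- Algebras have a setoid as universe, as in the standard library.  For each
-- similarity type there is a record of bare operations on a fixed setoid;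
-- compatibility of the operations with _≈_ belongs to the corresponding
-- `Is…` predicate.  Index i ∈ {1,…,n} is represented by an element of Fin n.

Op₃ : Set c → Set c
Op₃ A = A → A → A → A

-- point i y z is the tuple (w₁,…,wₙ) with wᵢ = z and wₖ = y for k ≠ i.

point : {A : Set c} {n : ℕ} → Fin n → A → A → Vector A n
point {n = n} i y z = updateAt (replicate n y) i (const z)

-- nest t x y is t₁(x, t₂(x, … tₙ₋₁(x, yₙ, yₙ₋₁) …, y₂), y₁); tₙ is not used.

nest : {A : Set c} {n : ℕ} .{{_ : NonTrivial n}} →
       Vector (Op₃ A) n → A → Vector A n → A
nest {n = suc (suc zero)}    t x y = head t x (head (tail y)) (head y)
nest {n = suc (suc (suc _))} t x y = head t x (nest (tail t) x (tail y)) (head y)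

record NBAOps (S : Setoid c ℓ) (n : ℕ) : Set c where
  open Setoid S using (Carrier)
  field
    q : Carrier → Vector Carrier n → Carrier
    e : Fin n → Carrier

record IsNBA {S : Setoid c ℓ} {n : ℕ} (𝐀 : NBAOps S n) : Set (c ⊔ ℓ) where
  open Setoid S using (Carrier; _≈_)
  open NBAOps 𝐀
  field
    q-cong : ∀ {x x′ : Carrier} {y y′ : Vector Carrier n} →
             x ≈ x′ → (∀ i → y i ≈ y′ i) → q x y ≈ q x′ y′
    B0 : ∀ (i : Fin n) (x : Vector Carrier n) → q (e i) x ≈ x i
    B1 : ∀ (y x : Carrier) → q y (replicate n x) ≈ x
    B2 : ∀ (y : Carrier) (x : Vector (Vector Carrier n) n) →
         q y (λ i → q y (x i)) ≈ q y (λ i → x i i)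
    -- The column x¹⁰,…,xⁿ⁰ is x₀; the remaining n × n entries are x.
    B3 : ∀ (y : Carrier) (x₀ : Vector Carrier n) (x : Vector (Vector Carrier n) n) →
         q y (λ i → q (x₀ i) (x i)) ≈ q (q y x₀) (λ j → q y (λ i → x i j))
    B4 : ∀ (y : Carrier) → q y e ≈ y

record Ops₃₀ (S : Setoid c ℓ) : Set c where
  constructor ops₃₀
  open Setoid S using (Carrier)
  field
    t  : Op₃ Carrier
    0# : Carrier

square : {S : Setoid c ℓ} → Ops₃₀ S → Ops₃₀ (×-setoid S S)
square (ops₃₀ t 0#) = ops₃₀
  (λ { (a , a′) (b , b′) (d , d′) → t a b d , t a′ b′ d′ })
  (0# , 0#)

record IsHomomorphism {S : Setoid c ℓ} {T : Setoid c′ ℓ′}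
                      (𝐀 : Ops₃₀ S) (𝐁 : Ops₃₀ T)
                      (h : Setoid.Carrier S → Setoid.Carrier T) :
                      Set (c ⊔ ℓ ⊔ ℓ′) where
  open Setoid T using (_≈_)
  private
    module A = Ops₃₀ 𝐀
    module B = Ops₃₀ 𝐁
    module S = Setoid S
  field
    cong    : ∀ {a a′} → a S.≈ a′ → h a ≈ h a′
    t-homo  : ∀ a b d → h (A.t a b d) ≈ B.t (h a) (h b) (h d)
    0#-homo : h A.0# ≈ B.0#

record IsDecompositionOperator {S : Setoid c ℓ} (𝐀 : Ops₃₀ S)
         (f : Setoid.Carrier S → Setoid.Carrier S → Setoid.Carrier S) :
         Set (c ⊔ ℓ) where
  open Setoid S using (_≈_)
  field
    idem     : ∀ a → f a a ≈ a
    diagonal : ∀ a b c d → f (f a b) (f c d) ≈ f a d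
    homo     : IsHomomorphism (square 𝐀) 𝐀 (uncurry f)

record IsSRCA {S : Setoid c ℓ} (𝐀 : Ops₃₀ S) : Set (c ⊔ ℓ) where
  open Setoid S using (_≈_)
  open Ops₃₀ 𝐀
  field
    t-cong        : ∀ {x x′ y y′ z z′} → x ≈ x′ → y ≈ y′ → z ≈ z′ →
                    t x y z ≈ t x′ y′ z′
    church        : ∀ x y → t 0# x y ≈ y
    semicentral   : ∀ x → t x x 0# ≈ x
    decomposition : ∀ x → IsDecompositionOperator 𝐀 (t x)

record SkewStarOps (S : Setoid c ℓ) (n : ℕ) : Set c where
  open Setoid S using (Carrier)
  field
    t  : Vector (Op₃ Carrier) n
    0# : Fin n → Carrier

record IsSkewStar {S : Setoid c ℓ} {n : ℕ} .{{_ : NonTrivial n}}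
                  (𝐁 : SkewStarOps S n) : Set (c ⊔ ℓ) where
  open Setoid S using (Carrier; _≈_)
  open SkewStarOps 𝐁
  field
    -- Compatibility of each t i with _≈_ is supplied by IsSRCA.t-cong.
    N0 : ∀ (i : Fin n) → IsSRCA {S = S} (ops₃₀ (t i) (0# i))
    N1 : ∀ {i j : Fin n} → i ≢ j → ∀ y z → t i (0# j) y z ≈ y
    N2 : ∀ (x : Carrier) → nest t x 0# ≈ x
    N3 : ∀ {i j : Fin n} → i ≢ j → ∀ x y z u →
         t i x (t j x y z) u ≈ t j x (t i x y u) z
    N4 : ∀ (i : Fin n) (x y z : Carrier) → t i x y z ≈ nest t x (point i y z)
    N5 : ∀ {i j : Fin n} → i ≢ j → ∀ x y¹ y² y³ z¹ z² z³ →
         t i x (t j y¹ y² y³) (t j z¹ z² z³) ≈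
         t j (t i x y¹ z¹) (t i x y² z²) (t i x y³ z³)

infix 8 _* _•

_* : {S : Setoid c ℓ} {n : ℕ} → NBAOps S n → SkewStarOps S n
𝐀 * = record
  { t  = λ i x y z → q x (point i y z)
  ; 0# = e
  } where open NBAOps 𝐀

_• : {S : Setoid c ℓ} {n : ℕ} .{{_ : NonTrivial n}} → SkewStarOps S n → NBAOps S n
𝐁 • = record
  { q = nest t
  ; e = 0#
  } where open SkewStarOps 𝐁

-- Equality of two algebras with the same universe: all basic operations agree.

infix 4 _≈ⁿᵇᵃ_ _≈ˢˢ_

_≈ⁿᵇᵃ_ : {S : Setoid c ℓ} {n : ℕ} → NBAOps S n → NBAOps S n → Set (c ⊔ ℓ)
_≈ⁿᵇᵃ_ {S = S} 𝐀 𝐀′ = (∀ x y → A.q x y ≈ A′.q x y) × (∀ i → A.e i ≈ A′.e i)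
  where
  open Setoid S using (_≈_)
  module A  = NBAOps 𝐀
  module A′ = NBAOps 𝐀′

_≈ˢˢ_ : {S : Setoid c ℓ} {n : ℕ} → SkewStarOps S n → SkewStarOps S n → Set (c ⊔ ℓ)
_≈ˢˢ_ {S = S} 𝐁 𝐁′ = (∀ i x y z → B.t i x y z ≈ B′.t i x y z) × (∀ i → B.0# i ≈ B′.0# i)
  where
  open Setoid S using (_≈_)
  module B  = SkewStarOps 𝐁
  module B′ = SkewStarOps 𝐁′

{-# OPTIONS --safe #-}

-- Fixing x, the maps tᵢ(x,-,-) behave as on a product of n factors: tᵢ(x,a,b)
-- takes its i-th coordinate from b and all others from a, and q(x,y₁,…,yₙ)
-- takes its k-th coordinate from yₖ.  From a skew star algebra, (B2) follows by
-- induction on the nesting depth because tᵢ(x,-,-) commutes with the inner nest,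
-- and (B3) is a composite of the interchange laws of the single tᵢ.  From an
-- nBA, (B2) shows that the coordinates determine an element, so nest and q
-- agree because both have k-th coordinate yₖ.

module Submission where

open import Defs
open import Data.Fin.Base using (Fin; zero; suc)
open import Data.Fin.Properties using (_≟_; suc-injective)
open import Data.Nat.Base using (ℕ; zero; suc; NonTrivial)
open import Data.Product.Base using (_×_; _,_; proj₁; proj₂; uncurry)
open import Data.Vec.Functional using (Vector; tail; replicate; updateAt)
open import Data.Vec.Functional.Properties using (updateAt-updates; updateAt-minimal)
open import Function.Base using (const; _∘_)
open import Level using (Level)
open import Relation.Binary.Bundles using (Setoid)
open import Relation.Binary.Core using (Rel)
open import Relation.Binary.Definitions using (Transitive)
open import Relation.Binary.PropositionalEquality.Core as ≡ using (_≡_; _≢_)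
open import Relation.Nullary.Decidable.Core using (yes; no)
import Relation.Binary.Reasoning.Setoid as SetoidReasoning

private
  variable
    a b r : Level
    A : Set a
    B : Set b
    n : ℕ

-- Tuples `point i y z` and projections of `nest`, for arbitrary relations.

point-updates : ∀ (i : Fin n) (y z : A) → point i y z i ≡ z
point-updates i y z = updateAt-updates i (replicate _ y)

point-minimal : ∀ {i k : Fin n} (y z : A) → k ≢ i → point i y z k ≡ y
point-minimal {i = i} {k} y z k≢i = updateAt-minimal k i (replicate _ y) k≢i

point-elim : (P : Fin n → A → Set r) (i : Fin n) {y z : A} →
             P i z → (∀ k → k ≢ i → P k y) → ∀ k → P k (point i y z k)
point-elim P i {y} {z} Pz Py k with k ≟ i
... | yes ≡.refl = ≡.subst (P i) (≡.sym (point-updates i y z)) Pz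
... | no  k≢i    = ≡.subst (P k) (≡.sym (point-minimal y z k≢i)) (Py k k≢i)

-- The entry types may differ, so that a tuple of elements can be matched with a tuple of rows or
-- pairs that represent them.
point-elim₂ : (R : Fin n → A → B → Set r) (i : Fin n) {y z : A} {y′ z′ : B} →
              R i z z′ → (∀ k → k ≢ i → R k y y′) →
              ∀ k → R k (point i y z k) (point i y′ z′ k)
point-elim₂ R i {y′ = y′} {z′} Rz Ry = point-elim (λ k v → R k v (point i y′ z′ k)) i
  (≡.subst (R i _) (≡.sym (point-updates i y′ z′)) Rz)
  (λ k k≢i → ≡.subst (R k _) (≡.sym (point-minimal y′ z′ k≢i)) (Ry k k≢i))

-- Layers before `i` pass to the nest inside them, and layer `i` returns `y i`. Only the outermost
-- layer is rewritten each time, so transitivity of `_∼_` suffices; this allows equality of a single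
-- coordinate as well as `_≈_`.
nest-select : .{{_ : NonTrivial n}} (_∼_ : Rel A r) → Transitive _∼_ →
              (t : Vector (Op₃ A) n) (x : A) (i : Fin n) →
              (∀ y z → t i x y z ∼ z) →
              (∀ j → j ≢ i → ∀ y z → t j x y z ∼ y) →
              ∀ y → nest t x y ∼ y i
nest-select {n = suc (suc zero)}    _ _ t x zero second first y = second _ _
nest-select {n = suc (suc (suc _))} _ _ t x zero second first y = second _ _
-- The last entry has no layer of its own: it is the first argument of the innermost operation.
nest-select {n = suc (suc zero)}    _ _ t x (suc zero) second first y = first zero (λ ()) _ _
nest-select {n = suc (suc (suc _))} _∼_ trans t x (suc i) second first y =
  trans (first zero (λ ()) _ _)
        (nest-select _∼_ trans (tail t) x i second
          (λ j j≢i → first (suc j) (j≢i ∘ suc-injective)) (tail y))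

module _ {c ℓ : Level} (S : Setoid c ℓ) where
  open Setoid S
  open SetoidReasoning S

  -- Identities of nested operations.

  Congruent₃ : Op₃ Carrier → Set _
  Congruent₃ t = ∀ {x x′ y y′ z z′} → x ≈ x′ → y ≈ y′ → z ≈ z′ → t x y z ≈ t x′ y′ z′

  Interchange : (Carrier → Carrier → Carrier) → Op₃ Carrier → Set _
  Interchange f t = ∀ x y z x′ y′ z′ →
    f (t x y z) (t x′ y′ z′) ≈ t (f x x′) (f y y′) (f z z′)

  nest-cong : .{{_ : NonTrivial n}} (t : Vector (Op₃ Carrier) n) →
              (∀ i → Congruent₃ (t i)) →
              ∀ {x x′ y y′} → x ≈ x′ → (∀ i → y i ≈ y′ i) → nest t x y ≈ nest t x′ y′
  nest-cong {n = suc (suc zero)}    t t-cong x≈ y≈ = t-cong zero x≈ (y≈ (suc zero)) (y≈ zero)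
  nest-cong {n = suc (suc (suc _))} t t-cong x≈ y≈ =
    t-cong zero x≈ (nest-cong (tail t) (t-cong ∘ suc) x≈ (y≈ ∘ suc)) (y≈ zero)

  nest-idem : .{{_ : NonTrivial n}} (t : Vector (Op₃ Carrier) n) →
              (∀ i → Congruent₃ (t i)) →
              ∀ x → (∀ i y → t i x y y ≈ y) → ∀ y → nest t x (replicate n y) ≈ y
  nest-idem {n = suc (suc zero)}    t t-cong x idem y = idem zero y
  nest-idem {n = suc (suc (suc _))} t t-cong x idem y =
    trans (t-cong zero refl (nest-idem (tail t) (t-cong ∘ suc) x (idem ∘ suc) y) refl)
          (idem zero y)

  nest-interchange : .{{_ : NonTrivial n}} (t : Vector (Op₃ Carrier) n) →
                     (∀ i → Congruent₃ (t i)) →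
                     ∀ f → (∀ i → Interchange f (t i)) → ∀ x y x′ y′ →
                     f (nest t x y) (nest t x′ y′) ≈ nest t (f x x′) (λ i → f (y i) (y′ i))
  nest-interchange {n = suc (suc zero)}    t t-cong f f-t x y x′ y′ = f-t zero _ _ _ _ _ _
  nest-interchange {n = suc (suc (suc _))} t t-cong f f-t x y x′ y′ =
    trans (f-t zero _ _ _ _ _ _)
          (t-cong zero refl
            (nest-interchange (tail t) (t-cong ∘ suc) f (f-t ∘ suc) x (tail y) x′ (tail y′))
            refl)

  -- The induction peels the outer nest and keeps the inner one whole, hence two families of
  -- independent lengths. (B3) is the case where they coincide.
  nest-nest-interchange :
    ∀ {m} .{{_ : NonTrivial m}} .{{_ : NonTrivial n}}
    (s : Vector (Op₃ Carrier) m) → (∀ i → Congruent₃ (s i)) →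
    (t : Vector (Op₃ Carrier) n) → (∀ i → Congruent₃ (t i)) →
    ∀ x → (∀ i j → Interchange (s i x) (t j)) →
    ∀ (y : Vector Carrier m) (z : Vector (Vector Carrier n) m) →
    nest s x (λ i → nest t (y i) (z i)) ≈ nest t (nest s x y) (λ j → nest s x (λ i → z i j))
  nest-nest-interchange {m = suc (suc zero)} s s-cong t t-cong x s-t y z =
    nest-interchange t t-cong (s zero x) (s-t zero) _ _ _ _
  nest-nest-interchange {m = suc (suc (suc _))} s s-cong t t-cong x s-t y z =
    trans (s-cong zero refl
            (nest-nest-interchange (tail s) (s-cong ∘ suc) t t-cong x (s-t ∘ suc) (tail y) (tail z))
            refl)
          (nest-interchange t t-cong (s zero x) (s-t zero) _ _ _ _)

  nest-diagonal : .{{_ : NonTrivial n}} (t : Vector (Op₃ Carrier) n) →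
                  (∀ i → Congruent₃ (t i)) → ∀ x →
                  (∀ i y → t i x y y ≈ y) →
                  (∀ i y z u v → t i x (t i x y z) (t i x u v) ≈ t i x y v) →
                  (∀ i j → Interchange (t i x) (t j)) →
                  ∀ (y : Vector (Vector Carrier n) n) →
                  nest t x (λ i → nest t x (y i)) ≈ nest t x (λ i → y i i)
  nest-diagonal {n = suc (suc zero)} t t-cong x idem diagonal t-t y = diagonal zero _ _ _ _
  nest-diagonal {n = suc (suc (suc _))} t t-cong x idem diagonal t-t y = begin
    f (N (λ i → f (N (tail (y (suc i)))) (y (suc i) zero))) (f (N (tail (y zero))) (y zero zero))
      -- Pulling `f` out of `N` creates the shape to which `diagonal` applies; it then discards the
      -- first row and first column except for their common entry.
      ≈⟨ t-cong zero refl (sym N-f) refl ⟩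
    f (f (N (λ i → N (tail (y (suc i))))) (N (λ i → y (suc i) zero)))
      (f (N (tail (y zero))) (y zero zero))
      ≈⟨ diagonal zero _ _ _ _ ⟩
    f (N (λ i → N (tail (y (suc i))))) (y zero zero)
      ≈⟨ t-cong zero refl
           (nest-diagonal (tail t) (t-cong ∘ suc) x (idem ∘ suc) (diagonal ∘ suc)
             (λ i j → t-t (suc i) (suc j)) (λ i → tail (y (suc i))))
           refl ⟩
    f (N (λ i → y (suc i) (suc i))) (y zero zero) ∎
    where
    f : Carrier → Carrier → Carrier
    f = t zero x
    N : Vector Carrier _ → Carrier
    N = nest (tail t) x
    N-f : ∀ {u v} → f (N u) (N v) ≈ N (λ i → f (u i) (v i))
    -- Interchange turns the base point `x` into `f x x`; idempotence restores it.
    N-f = trans (nest-interchange (tail t) (t-cong ∘ suc) f (t-t zero ∘ suc) x _ x _)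
                (nest-cong (tail t) (t-cong ∘ suc) (idem zero x) (λ _ → refl))

  -- From skew star algebras to nBAs.

  module _ .{{_ : NonTrivial n}} {𝐁 : SkewStarOps S n} (isSkewStar : IsSkewStar 𝐁) where
    open SkewStarOps 𝐁
    open IsSkewStar isSkewStar
    private
      module SRCA i = IsSRCA (N0 i)
      module Decomposition i x = IsDecompositionOperator (SRCA.decomposition i x)

    -- (N5) covers distinct indices; for equal ones this is the homomorphism condition in (N0).
    •-interchange : ∀ x i j → Interchange (t i x) (t j)
    •-interchange x i j with i ≟ j
    ... | no  i≢j    = λ _ _ _ _ _ _ → N5 i≢j x _ _ _ _ _ _
    ... | yes ≡.refl = λ _ _ _ _ _ _ → IsHomomorphism.t-homo (Decomposition.homo i x) _ _ _

    •-isNBA : IsNBA (𝐁 •)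
    •-isNBA = record
      { q-cong = nest-cong t SRCA.t-cong
      ; B0 = λ i → nest-select _≈_ trans t (0# i) i (SRCA.church i) (λ _ → N1)
      ; B1 = λ x → nest-idem t SRCA.t-cong x (λ i → Decomposition.idem i x)
      ; B2 = λ x → nest-diagonal t SRCA.t-cong x (λ i → Decomposition.idem i x)
                     (λ i → Decomposition.diagonal i x) (•-interchange x)
      ; B3 = λ x → nest-nest-interchange t SRCA.t-cong t SRCA.t-cong x (•-interchange x)
      ; B4 = N2
      }

  -- From nBAs to skew star algebras.

  module _ {𝐀 : NBAOps S n} (isNBA : IsNBA 𝐀) where
    open NBAOps 𝐀
    open IsNBA isNBA
    open SkewStarOps (𝐀 *) using (t)

    t-cong : ∀ i → Congruent₃ (t i)
    t-cong i x≈ y≈ z≈ = q-cong x≈ (point-elim₂ (λ _ → _≈_) i z≈ (λ _ _ → y≈))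

    -- (B2) for the matrix with i-th row `v` and all other rows `u`, whose diagonal is `w`.
    -- Identities with a fixed `x` thereby reduce to comparing tuples entry by entry.
    paste : ∀ i x {y z u v w} → y ≈ q x u → z ≈ q x v →
            v i ≈ w i → (∀ k → k ≢ i → u k ≈ w k) → t i x y z ≈ q x w
    paste i x {y} {z} {u} {v} {w} y≈ z≈ v≈w u≈w = begin
      q x (point i y z)
        ≈⟨ q-cong refl (point-elim₂ (λ _ s s′ → s ≈ q x s′) i z≈ (λ _ _ → y≈)) ⟩
      q x (λ k → q x (point i u v k))
        ≈⟨ B2 x (point i u v) ⟩
      q x (λ k → point i u v k k)
        ≈⟨ q-cong refl (point-elim (λ k (s : Vector Carrier n) → s k ≈ w k) i v≈w u≈w) ⟩
      q x w ∎

    q-const : ∀ x y → y ≈ q x (replicate n y)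
    q-const x y = sym (B1 x y)

    t-idem : ∀ i x y → t i x y y ≈ y
    t-idem i x y = trans (q-cong refl (point-elim (λ _ → _≈ y) i refl (λ _ _ → refl))) (B1 x y)

    t-q-interchange : ∀ i x y u y′ u′ →
                      t i x (q y u) (q y′ u′) ≈ q (t i x y y′) (λ j → t i x (u j) (u′ j))
    t-q-interchange i x y u y′ u′ = begin
      t i x (q y u) (q y′ u′)
        -- (B3) needs every entry in the form `q` of something, so the tuple is lifted to the tuple
        -- `p` of pairs.
        ≈⟨ q-cong refl (point-elim₂ (λ _ s p → s ≈ uncurry q p) i refl (λ _ _ → refl)) ⟩
      q x (λ k → uncurry q (p k))
        ≈⟨ B3 x (proj₁ ∘ p) (proj₂ ∘ p) ⟩
      q (q x (proj₁ ∘ p)) (λ j → q x (λ k → proj₂ (p k) j))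
        ≈⟨ q-cong (project proj₁) (λ j → project (λ r → proj₂ r j)) ⟩
      q (t i x y y′) (λ j → t i x (u j) (u′ j)) ∎
      where
      p : Vector (Carrier × Vector Carrier n) n
      p = point i (y , u) (y′ , u′)
      project : ∀ (f : Carrier × Vector Carrier n → Carrier) →
                q x (f ∘ p) ≈ t i x (f (y , u)) (f (y′ , u′))
      project f = q-cong refl (point-elim₂ (λ _ r s → f r ≈ s) i refl (λ _ _ → refl))

    -- Here `i` and `j` may be equal, so this gives both (N5) and the homomorphism condition in
    -- (N0).
    *-interchange : ∀ i j x → Interchange (t i x) (t j)
    *-interchange i j x y z u y′ z′ u′ = begin
      t i x (t j y z u) (t j y′ z′ u′)
        ≈⟨ t-q-interchange i x y (point j z u) y′ (point j z′ u′) ⟩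
      q (t i x y y′) (λ k → t i x (point j z u k) (point j z′ u′ k))
        ≈⟨ q-cong refl (λ k → sym (split k)) ⟩
      t j (t i x y y′) (t i x z z′) (t i x u u′) ∎
      where
      split : ∀ k → point j (t i x z z′) (t i x u u′) k ≈ t i x (point j z u k) (point j z′ u′ k)
      split = point-elim (λ k s → s ≈ t i x (point j z u k) (point j z′ u′ k)) j
        (t-cong i refl (reflexive (≡.sym (point-updates j z u)))
                       (reflexive (≡.sym (point-updates j z′ u′))))
        (λ k k≢j → t-cong i refl (reflexive (≡.sym (point-minimal z u k≢j)))
                                 (reflexive (≡.sym (point-minimal z′ u′ k≢j))))

    t-e : ∀ i y z → t i (e i) y z ≈ z
    t-e i y z = trans (B0 i _) (reflexive (point-updates i y z))

    -- Both sides are `q x w`, where `w` has `u` at `i`, `z` at `j` and `y` elsewhere.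
    t-swap : ∀ {i j} → i ≢ j → ∀ x y z u → t i x (t j x y z) u ≈ t j x (t i x y u) z
    t-swap {i} {j} i≢j x y z u = trans
      (paste i x refl (q-const x u) (reflexive (≡.sym (updateAt-updates i (point j y z))))
        (λ k k≢i → reflexive (≡.sym (updateAt-minimal k i (point j y z) k≢i))))
      (sym (paste j x refl (q-const x z)
        (reflexive (≡.sym (≡.trans (updateAt-minimal j i (point j y z) (i≢j ∘ ≡.sym))
                                   (point-updates j y z))))
        -- `point-elim` only separates `k` from `i`, so the predicate carries `k ≢ j` along.
        (point-elim (λ k s → k ≢ j → s ≈ w k) i
          (λ _ → reflexive (≡.sym (updateAt-updates i (point j y z))))
          (λ k k≢i k≢j → reflexive (≡.sym (≡.trans (updateAt-minimal k i (point j y z) k≢i)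
                                                   (point-minimal y z k≢j)))))))
      where
      w : Vector Carrier n
      w = updateAt (point j y z) i (const u)

    t-isDecompositionOperator : ∀ i x → IsDecompositionOperator (ops₃₀ {S = S} (t i) (e i)) (t i x)
    t-isDecompositionOperator i x = record
      { idem     = t-idem i x
      ; diagonal = λ y z u v → paste i x refl refl
          (reflexive (≡.trans (point-updates i u v) (≡.sym (point-updates i y v))))
          (λ k k≢i → reflexive (≡.trans (point-minimal y z k≢i) (≡.sym (point-minimal y v k≢i))))
      ; homo     = record
          { cong    = uncurry (t-cong i refl)
          ; t-homo  = λ _ _ _ → *-interchange i i x _ _ _ _ _ _
          ; 0#-homo = t-idem i x (e i)
          }
      }

    t-isSRCA : ∀ i → IsSRCA (ops₃₀ {S = S} (t i) (e i))
    t-isSRCA i = record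
      { t-cong        = t-cong i
      ; church        = t-e i
      -- By (B4), `x` is `q x e`; its i-th entry is already `e i`, so pasting `e i` there changes
      -- nothing.
      ; semicentral   = λ x → trans
          (paste i x (sym (B4 x)) (q-const x (e i)) refl (λ _ _ → refl)) (B4 x)
      ; decomposition = t-isDecompositionOperator i
      }

    -- z ↦ t k x x z extracts the k-th coordinate of z; its first argument x is
    -- an arbitrary base point for the other coordinates.
    infix 4 _≈[_,_]_
    _≈[_,_]_ : Carrier → Carrier → Fin n → Carrier → Set ℓ
    y ≈[ x , k ] z = t k x x y ≈ t k x x z

    q-coordinate : ∀ x y k → q x y ≈[ x , k ] y k
    q-coordinate x y k = paste k x (q-const x x) refl
      (reflexive (≡.sym (point-updates k x (y k))))
      (λ j j≢k → reflexive (≡.sym (point-minimal x (y k) j≢k)))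

    -- (B2) reassembles an element from its extracts: the diagonal of the rows `point k x y` is
    -- constantly `y`.
    coordinates-injective : ∀ x {y z} → (∀ k → y ≈[ x , k ] z) → y ≈ z
    coordinates-injective x {y} {z} y≈z = begin
      y                      ≈⟨ assemble y ⟩
      q x (λ k → t k x x y)  ≈⟨ q-cong refl y≈z ⟩
      q x (λ k → t k x x z)  ≈⟨ assemble z ⟨
      z                      ∎
      where
      assemble : ∀ y → y ≈ q x (λ k → t k x x y)
      assemble y = sym (begin
        q x (λ k → t k x x y)     ≈⟨ B2 x _ ⟩
        q x (λ k → point k x y k) ≈⟨ q-cong refl (λ k → reflexive (point-updates k x y)) ⟩
        q x (replicate n y)       ≈⟨ B1 x y ⟩
        y                         ∎)

    -- `nest-select` is applied to equality of k-th coordinates, for which `t k x u v` is related to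
    -- `v`, and `t j x u v` with `j ≢ k` to `u`. This also yields (N2) and (N4).
    nest-t≈q : .{{_ : NonTrivial n}} → ∀ x y → nest t x y ≈ q x y
    nest-t≈q x y = coordinates-injective x λ k → trans
      (nest-select (_≈[ x , k ]_) trans t x k
        (λ u v → trans (q-coordinate x (point k u v) k)
                       (t-cong k refl refl (reflexive (point-updates k u v))))
        (λ j j≢k u v → trans (q-coordinate x (point j u v) k)
                             (t-cong k refl refl (reflexive (point-minimal u v (j≢k ∘ ≡.sym)))))
        y)
      (sym (q-coordinate x y k))

    *-isSkewStar : .{{_ : NonTrivial n}} → IsSkewStar (𝐀 *)
    *-isSkewStar = record
      { N0 = t-isSRCA
      ; N1 = λ i≢j y z → trans (B0 _ _) (reflexive (point-minimal y z (i≢j ∘ ≡.sym)))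
      ; N2 = λ x → trans (nest-t≈q x e) (B4 x)
      ; N3 = t-swap
      ; N4 = λ i x y z → sym (nest-t≈q x (point i y z))
      ; N5 = λ {i} {j} _ x _ _ _ _ _ _ → *-interchange i j x _ _ _ _ _ _
      }

theorem5p2 : ∀ {c ℓ : Level} (n : ℕ) .{{_ : NonTrivial n}} (S : Setoid c ℓ) →
    ((𝐀 : NBAOps S n) → IsNBA 𝐀 → IsSkewStar (𝐀 *)) ×
    ((𝐁 : SkewStarOps S n) → IsSkewStar 𝐁 → IsNBA (𝐁 •)) ×
    ((𝐀 : NBAOps S n) → IsNBA 𝐀 → (𝐀 *) • ≈ⁿᵇᵃ 𝐀) ×
    ((𝐁 : SkewStarOps S n) → IsSkewStar 𝐁 → (𝐁 •) * ≈ˢˢ 𝐁)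
theorem5p2 n S =
  (λ _ 𝐀-isNBA → *-isSkewStar S 𝐀-isNBA) ,
  (λ _ 𝐁-isSkewStar → •-isNBA S 𝐁-isSkewStar) ,
  (λ _ 𝐀-isNBA → nest-t≈q S 𝐀-isNBA , λ _ → Setoid.refl S) ,
  (λ _ 𝐁-isSkewStar →
    -- The operations of `(𝐁 •) *` unfold to the right-hand side of (N4).
    (λ i x y z → Setoid.sym S (IsSkewStar.N4 𝐁-isSkewStar i x y z)) , λ _ → Setoid.refl S)
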